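{- Let $I$ be a finite set of positive integers and $m=\max(I\cup\{0\})$. Then, as polynomials in $n$, $$d(I;n)=\sum_{k=0}^{m} a_k(I)\binom{n-m}{k},$$ where $a_0(I)=0$ and, for $1\le k\le m$, $a_k(I)$ is the number of permutations $\pi\in\mathfrak S_{2m}$ with $\mathrm{Des}\,\pi=I$ such that $\{\pi_1,\dots,\pi_m\}\cap[m+1,2m]=[m+1,m+k]$. Moreover $a_k(I)>0$ for all $1\le k\le m$.
   Context: For integers $a\le b$, $[a,b]=\{a,a+1,\dots,b\}$. For a permutation $\pi=\pi_1\cdots\pi_n$ of $[n]$, $\mathrm{Des}\,\pi=\{i\mid \pi_i>\pi_{i+1}\}$. For $n>m$, $d(I;n)=\#\{\pi\in\mathfrak S_n\mid \mathrm{Des}\,\pi=I\}$; this is a polynomial in $n$ of degree $m$, and the identity is an identity of polynomials (equivalently, it holds for all integers $n>m$).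
   Formalization: The set I is assumed nonempty: for I = ∅ one has m = 0 and d(∅;n) = 1, while the right-hand side is a_0(∅) = 0, so the identity fails in that case. -}

module Defs where

open import Data.Fin using (Fin; toℕ)
import Data.Fin as Fin
import Data.Fin.Properties as Fin
open import Data.List using (List; []; _∷_; [_]; length; filter; allFin; cartesianProductWith; applyUpTo)
open import Data.List.Extrema.Nat using (max; xs≤max)
open import Data.List.Membership.Propositional using (_∈_)
open import Data.List.Membership.DecPropositional using (_∈?_)
import Data.List.Relation.Unary.All as All
open import Data.Nat using (ℕ; zero; suc; _+_; _*_; _≤_; _<_; s≤s; _≟_; _≤?_; _<?_)
open import Data.Nat.ListAction using (sum)
open import Data.Nat.Properties using (allUpTo?)
open import Data.Product using (∃-syntax; _×_; _,_)
open import Data.Vec using (Vec; []; _∷_; lookup)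
import Data.Vec.Relation.Unary.AllPairs as AllPairs
open import Data.Vec.Relation.Unary.Unique.Propositional using (Unique)
open import Level using (0ℓ)
open import Relation.Binary.PropositionalEquality using (_≡_; refl)
open import Relation.Nullary using (Dec; ¬?)
open import Relation.Nullary.Decidable using (map′; _×-dec_; _→-dec_)
open import Relation.Unary using (Pred; Decidable; _⊆_; _≐_; _∩_)

words : ∀ k n → List (Vec (Fin k) n)
words k zero    = [ [] ]
words k (suc n) = cartesianProductWith _∷_ (allFin k) (words k n)

-- Permutations are in one-line notation.  Positions and letters are both
-- stored 0-based, so π₁ ⋯ πₙ is the word whose entry at p is πₚ₊₁ − 1.
unique? : ∀ {k n} → Decidable (Unique {A = Fin k} {n})
unique? = AllPairs.allPairs? (λ x y → ¬? (x Fin.≟ y))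

𝔖 : ∀ n → List (Vec (Fin n) n)
𝔖 n = filter unique? (words n n)

-- The number of π ∈ 𝔖 n satisfying P; `words` has no repetitions.
count : ∀ n {P : Pred (Vec (Fin n) n) 0ℓ} → Decidable P → ℕ
count n P? = length (filter P? (𝔖 n))

-- i is a 1-based position: p and q are the 0-based forms of i and i + 1.
Des : ∀ {n} → Vec (Fin n) n → Pred ℕ 0ℓ
Des {n} π i = ∃[ p ] ∃[ q ] suc (toℕ p) ≡ i × toℕ q ≡ i × lookup π q Fin.< lookup π p

-- { π₁ , … , πₘ }, with 1-based letters.
FirstLetters : ∀ {n} → ℕ → Vec (Fin n) n → Pred ℕ 0ℓ
FirstLetters m π v = ∃[ p ] toℕ p < m × suc (toℕ (lookup π p)) ≡ v

⟦_,_⟧ : ℕ → ℕ → Pred ℕ 0ℓ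
⟦ a , b ⟧ v = a ≤ v × v ≤ b

-- A list stands for the finite set of its members; order and repetitions are irrelevant.
HasDes : List ℕ → ∀ {n} → Pred (Vec (Fin n) n) 0ℓ
HasDes I π = Des π ≐ (_∈ I)

maxI : List ℕ → ℕ
maxI I = max 0 I

Counted : (I : List ℕ) (k : ℕ) → Pred (Vec (Fin (2 * maxI I)) (2 * maxI I)) 0ℓ
Counted I k π = HasDes I π
              × (FirstLetters m π ∩ ⟦ m + 1 , 2 * m ⟧) ≐ ⟦ m + 1 , m + k ⟧
  where m = maxI I

private
  ⊆-dec : ∀ {P Q : Pred ℕ 0ℓ} b → (∀ {x} → P x → x < b) →
          Decidable P → Decidable Q → Dec (P ⊆ Q)
  ⊆-dec {P} {Q} b P<b P? Q? = map′ to from (allUpTo? (λ x → P? x →-dec Q? x) b)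
    where
    to : (∀ {x} → x < b → P x → Q x) → P ⊆ Q
    to f p = f (P<b p) p
    from : P ⊆ Q → ∀ {x} → x < b → P x → Q x
    from f _ = f

  ≐-dec : ∀ {P Q : Pred ℕ 0ℓ} b c → (∀ {x} → P x → x < b) → (∀ {x} → Q x → x < c) →
          Decidable P → Decidable Q → Dec (P ≐ Q)
  ≐-dec b c P<b Q<c P? Q? = ⊆-dec b P<b P? Q? ×-dec ⊆-dec c Q<c Q? P?

des? : ∀ {n} (π : Vec (Fin n) n) → Decidable (Des π)
des? π i = Fin.any? λ p → Fin.any? λ q →
  (suc (toℕ p) ≟ i) ×-dec (toℕ q ≟ i) ×-dec (lookup π q Fin.<? lookup π p)

firstLetters? : ∀ {n} m (π : Vec (Fin n) n) → Decidable (FirstLetters m π)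
firstLetters? m π v = Fin.any? λ p →
  (toℕ p <? m) ×-dec (suc (toℕ (lookup π p)) ≟ v)

⟦_,_⟧? : ∀ a b → Decidable ⟦ a , b ⟧
⟦ a , b ⟧? v = (a ≤? v) ×-dec (v ≤? b)

hasDes? : ∀ I {n} → Decidable (HasDes I {n})
hasDes? I {n} π = ≐-dec n (suc (maxI I))
  (λ { (_ , q , _ , refl , _) → Fin.toℕ<n q })
  (λ i∈I → s≤s (All.lookup (xs≤max 0 I) i∈I))
  (des? π) (λ i → _∈?_ _≟_ i I)

counted? : ∀ I k → Decidable (Counted I k)
counted? I k π = hasDes? I π ×-dec
  ≐-dec (suc (2 * m)) (suc (m + k))
    (λ (_ , _ , v≤2m) → s≤s v≤2m) (λ (_ , v≤m+k) → s≤s v≤m+k)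
    (λ v → firstLetters? m π v ×-dec ⟦ m + 1 , 2 * m ⟧? v) ⟦ m + 1 , m + k ⟧?
  where m = maxI I

d : List ℕ → ℕ → ℕ
d I n = count n (hasDes? I)

a : ℕ → List ℕ → ℕ
a zero    I = 0
a (suc k) I = count (2 * maxI I) (counted? I (suc k))

-- f 0 + f 1 + ⋯ + f m
∑₀ : ℕ → (ℕ → ℕ) → ℕ
∑₀ m f = sum (applyUpTo f (suc m))

{-# OPTIONS --safe #-}
module Submission where

-- As m is the last descent, π increases after position m, so it is determined by its prefix
-- π₁ ⋯ πₘ.  Let f j N be the number of prefixes over [m + j + N] in which the letters
-- m + 1 , … , m + j all occur.  Either m + j + 1 occurs as well, or it can be deleted from
-- the alphabet by an order-preserving relabelling; hence f j (N + 1) = f j N + f (j + 1) N,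
-- and f 0 N = ∑ₖ f k 0 (N choose k) by Pascal's rule, where f k 0 = aₖ(I).
-- Deletion preserves the descent at m because some letter ≤ m below πₘ is always missing:
-- otherwise all of [m] would be used up, and the prefix would be a permutation of [m].
-- For positivity, shift a permutation of [m] with descents I ∖ {m} up by k ≥ 1.

open import Defs
open import Data.Fin using (Fin; zero; suc; toℕ; fromℕ<)
open import Data.Fin.Properties using (toℕ-injective; toℕ<n; toℕ-fromℕ<)
open import Data.List using (List; []; _∷_; length; map; filter; upTo; applyUpTo; take; drop; _++_)
open import Data.List.Extrema.Nat using (argmax-sel; xs≤max)
open import Data.List.Membership.DecPropositional using (_∈?_)
open import Data.List.Membership.Propositional using (_∈_; _∉_)
open import Data.List.Membership.Propositional.Properties
open import Data.List.Membership.Propositional.Properties.WithK using (unique∧set⇒bag)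
open import Data.List.Properties
  using (length-map; length-filter; length-upTo; length-applyUpTo; length-take; length-++; length-++-≤ˡ;
         filter-complete; take++drop≡id; map-∘; map-cong; map-id; ∷-injective)
open import Data.List.Relation.Binary.BagAndSetEquality using (∼bag⇒↭)
open import Data.List.Relation.Binary.Equality.Propositional using (≋⇒≡)
open import Data.List.Relation.Binary.Permutation.Propositional using (_↭_; ↭⇒↭ₛ)
open import Data.List.Relation.Binary.Permutation.Propositional.Properties using (↭-length)
open import Data.List.Relation.Unary.All as All using (All; []; _∷_)
import Data.List.Relation.Unary.All.Properties as All
open import Data.List.Relation.Unary.AllPairs as AllPairs using (AllPairs; []; _∷_)
import Data.List.Relation.Unary.AllPairs.Properties as AllPairs
open import Data.List.Relation.Unary.Any using (here; there)
import Data.List.Relation.Unary.Linked.Properties as Linked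
open import Data.List.Relation.Unary.Sorted.TotalOrder.Properties using (↗↭↗⇒≋)
open import Data.List.Relation.Unary.Unique.Propositional using (Unique)
import Data.List.Relation.Unary.Unique.Propositional.Properties as Unique
open import Data.Nat
open import Data.Nat.Combinatorics using (_C_; nCk+nC[k+1]≡[n+1]C[k+1])
open import Data.Nat.ListAction using (sum)
open import Data.Nat.Properties
open import Data.Nat.Solver using (module +-*-Solver)
open import Data.Product using (_×_; _,_; ∃; ∃-syntax; proj₁; proj₂)
open import Data.Unit using (⊤)
open import Data.Sum using (_⊎_; inj₁; inj₂; [_,_]′)
open import Data.Vec as Vec using (Vec; []; _∷_; toList)
import Data.Vec.Properties as Vec
import Data.Vec.Relation.Unary.All.Properties as VecAll
import Data.Vec.Relation.Unary.AllPairs as VecAllPairs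
import Data.Vec.Relation.Unary.Unique.Propositional as VecUnique
open import Function using (_∘_; id; _⇔_; mk⇔; Equivalence)
open import Level using (0ℓ)
open import Relation.Binary.Definitions using (tri<; tri≈; tri>)
open import Relation.Binary.PropositionalEquality
  using (_≡_; _≢_; _≗_; refl; sym; trans; cong; cong₂; subst; subst₂; module ≡-Reasoning)
open import Relation.Nullary using (¬_; ¬?; yes; no; contradiction)
open import Relation.Unary using (Pred; Decidable; _∩_; Empty)

open Equivalence using (to; from)

private
  variable
    A B : Set

-- Lists without repetitions

-- Injectivity is asked on members only: deleting a letter, or cutting a permutation down to its
-- prefix, is injective only on the words being counted.
unique-map : {f : A → B} {xs : List A} → (∀ {x y} → x ∈ xs → y ∈ xs → f x ≡ f y → x ≡ y) →
             Unique xs → Unique (map f xs)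
unique-map inj []          = []
unique-map inj (x∉xs ∷ u) =
  All.map⁺ (All.tabulate λ y∈xs fx≡fy → All.lookup x∉xs y∈xs (inj (here refl) (there y∈xs) fx≡fy))
  ∷ unique-map (λ x∈ y∈ → inj (there x∈) (there y∈)) u

unique-↭ : {xs ys : List A} → Unique xs → Unique ys → (∀ {x} → x ∈ xs ⇔ x ∈ ys) → xs ↭ ys
unique-↭ u v eq = ∼bag⇒↭ (unique∧set⇒bag u v eq)

module _ {xs ys : List ℕ} (u : Unique xs) (v : Unique ys) (xs⊆ys : ∀ {x} → x ∈ xs → x ∈ ys) where

  private
    ∈xs? : Decidable (_∈ xs)
    ∈xs? x = _∈?_ _≟_ x xs

    -- Filtering `ys` by membership in `xs` leaves exactly the members of `xs`, and two lists
    -- without repetitions and with the same members are permutations of each other.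
    length-common : length xs ≡ length (filter ∈xs? ys)
    length-common = ↭-length (unique-↭ u (Unique.filter⁺ ∈xs? v)
      (mk⇔ (λ x∈ → ∈-filter⁺ ∈xs? (xs⊆ys x∈) x∈) (proj₂ ∘ ∈-filter⁻ ∈xs? {xs = ys})))

  length-mono-⊆ : length xs ≤ length ys
  length-mono-⊆ = subst (_≤ length ys) (sym length-common) (length-filter ∈xs? ys)

  -- With equal lengths, that filter removes nothing from `ys`.
  pigeonhole : length xs ≡ length ys → ∀ {y} → y ∈ ys → y ∈ xs
  pigeonhole eq y∈ = proj₂ (∈-filter⁻ ∈xs? {xs = ys} (subst (_ ∈_)
    (sym (filter-complete ∈xs? (trans (sym length-common) eq))) y∈))

increasing⇒unique : ∀ {l} → AllPairs _<_ l → Unique l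
increasing⇒unique = AllPairs.map <⇒≢

increasing-≡ : ∀ {xs ys} → AllPairs _<_ xs → AllPairs _<_ ys → (∀ {x} → x ∈ xs ⇔ x ∈ ys) → xs ≡ ys
increasing-≡ s t eq = ≋⇒≡ (↗↭↗⇒≋ ≤-totalOrder (sorted s) (sorted t)
  (↭⇒↭ₛ (unique-↭ (increasing⇒unique s) (increasing⇒unique t) eq)))
  where
  sorted : ∀ {l} → AllPairs _<_ l → _
  sorted = Linked.AllPairs⇒Linked ∘ AllPairs.map <⇒≤

unique-++⁻ˡ : ∀ (xs : List A) {ys} → Unique (xs ++ ys) → Unique xs
unique-++⁻ˡ []       _        = []
unique-++⁻ˡ (x ∷ xs) (x∉ ∷ u) = All.++⁻ˡ xs x∉ ∷ unique-++⁻ˡ xs u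

++-disjoint : ∀ (xs : List A) {ys v} → Unique (xs ++ ys) → v ∈ xs → v ∉ ys
++-disjoint (x ∷ xs) (x∉ ∷ u) (here refl) v∈ys = All.lookup x∉ (∈-++⁺ʳ xs v∈ys) refl
++-disjoint (x ∷ xs) (x∉ ∷ u) (there v∈)  v∈ys = ++-disjoint xs u v∈ v∈ys

take-length-++ : ∀ (xs : List A) {ys} → take (length xs) (xs ++ ys) ≡ xs
take-length-++ []       = refl
take-length-++ (x ∷ xs) = cong (x ∷_) (take-length-++ xs)

-- Cardinalities

-- The enumeration is existential, so a size can be carried along bijections and equivalences
-- without fixing a list; `size-unique` makes the number well defined.
HasSize : Pred A 0ℓ → ℕ → Set
HasSize P c = ∃[ xs ] Unique xs × (∀ {x} → x ∈ xs ⇔ P x) × length xs ≡ c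

size-unique : {P : Pred A 0ℓ} {c d : ℕ} → HasSize P c → HasSize P d → c ≡ d
size-unique (xs , u , p , refl) (ys , v , q , refl) =
  ↭-length (unique-↭ u v (mk⇔ (from q ∘ to p) (from p ∘ to q)))

size-bijection : {P : Pred A 0ℓ} {Q : Pred B 0ℓ} {c : ℕ} (f : A → B) →
                 (∀ {x} → P x → Q (f x)) →
                 (∀ {x y} → P x → P y → f x ≡ f y → x ≡ y) →
                 (∀ {y} → Q y → ∃[ x ] P x × f x ≡ y) →
                 HasSize P c → HasSize Q c
size-bijection {Q = Q} f maps inj surj (xs , u , p , len) =
  map f xs ,
  unique-map (λ x∈ y∈ → inj (to p x∈) (to p y∈)) u ,
  mk⇔ (λ y∈ → let x , x∈ , y≡ = ∈-map⁻ f y∈ in subst Q (sym y≡) (maps (to p x∈)))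
      (λ qy → let x , px , fx≡ = surj qy in subst (_∈ map f xs) fx≡ (∈-map⁺ f (from p px))) ,
  trans (length-map f xs) len

size-cong : {P Q : Pred A 0ℓ} {c : ℕ} → (∀ {x} → P x ⇔ Q x) → HasSize P c → HasSize Q c
size-cong P⇔Q (xs , u , p , len) = xs , u , mk⇔ (to P⇔Q ∘ to p) (from p ∘ from P⇔Q) , len

size-empty : {P : Pred A 0ℓ} → Empty P → HasSize P 0
size-empty ¬P = [] , [] , mk⇔ (λ ()) (λ px → contradiction px (¬P _)) , refl

size-positive : {P : Pred A 0ℓ} {c : ℕ} → HasSize P c → ∃ P → 0 < c
size-positive (xs , u , p , refl) (x , px) = ∈-length (from p px)

size-filter : {P Q : Pred A 0ℓ} (Q? : Decidable Q) {xs : List A} → Unique xs → (∀ {x} → x ∈ xs ⇔ P x) →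
              HasSize (P ∩ Q) (length (filter Q? xs))
size-filter Q? {xs} u p = filter Q? xs , Unique.filter⁺ Q? u ,
  mk⇔ (λ x∈ → let x∈xs , q = ∈-filter⁻ Q? {xs = xs} x∈ in to p x∈xs , q)
      (λ (px , q) → ∈-filter⁺ Q? (from p px) q) ,
  refl

length-filter-split : {Q : Pred A 0ℓ} (Q? : Decidable Q) (xs : List A) →
                      length xs ≡ length (filter (¬? ∘ Q?) xs) + length (filter Q? xs)
length-filter-split Q? []       = refl
length-filter-split Q? (x ∷ xs) with Q? x
... | yes _ = trans (cong suc (length-filter-split Q? xs)) (sym (+-suc _ _))
... | no  _ = cong suc (length-filter-split Q? xs)

size-split : {P Q : Pred A 0ℓ} {c : ℕ} → Decidable Q → HasSize P c →
             ∃[ c₁ ] ∃[ c₂ ] HasSize (λ x → P x × ¬ Q x) c₁ × HasSize (P ∩ Q) c₂ × c ≡ c₁ + c₂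
size-split Q? (xs , u , p , len) =
  _ , _ , size-filter (¬? ∘ Q?) u p , size-filter Q? u p , trans (sym len) (length-filter-split Q? xs)

-- Descent patterns

-- Junk value 0 past the end.
at : List ℕ → ℕ → ℕ
at []      _       = 0
at (x ∷ l) zero    = x
at (x ∷ l) (suc i) = at l i

at-∈ : ∀ {i} l → i < length l → at l i ∈ l
at-∈ {zero}  (x ∷ l) _         = here refl
at-∈ {suc i} (x ∷ l) (s≤s i<) = there (at-∈ l i<)

at-map : ∀ (f : ℕ → ℕ) {i} l → i < length l → at (map f l) i ≡ f (at l i)
at-map f {zero}  (x ∷ l) _         = refl
at-map f {suc i} (x ∷ l) (s≤s i<) = at-map f l i<

at-++ˡ : ∀ {i} w t → i < length w → at (w ++ t) i ≡ at w i
at-++ˡ {zero}  (x ∷ w) t _        = refl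
at-++ˡ {suc i} (x ∷ w) t (s≤s i<) = at-++ˡ w t i<

at-++ʳ : ∀ w t i → at (w ++ t) (length w + i) ≡ at t i
at-++ʳ []      t i = refl
at-++ʳ (x ∷ w) t i = at-++ʳ w t i

at-distinct : ∀ {i l} → Unique l → suc i < length l → at l i ≢ at l (suc i)
at-distinct {zero}  {x ∷ y ∷ l} ((x≢y ∷ _) ∷ _) _        = x≢y
at-distinct {zero}  {x ∷ []}    _               (s≤s ())
at-distinct {suc i} {x ∷ l}     (_ ∷ u)         (s≤s i<) = at-distinct u i<

-- i is a 0-based position: it stands for the descent i + 1.
Pattern : Pred ℕ 0ℓ → List ℕ → Set
Pattern J l = ∀ {i} → suc i < length l → J i ⇔ at l (suc i) < at l i

increasing-at : ∀ {i l} → AllPairs _<_ l → suc i < length l → at l i < at l (suc i)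
increasing-at {zero}  {x ∷ y ∷ l} ((x<y ∷ _) ∷ _) _        = x<y
increasing-at {zero}  {x ∷ []}    _               (s≤s ())
increasing-at {suc i} {x ∷ l}     (_ ∷ s)         (s≤s i<) = increasing-at s i<

increasing-head : ∀ {v l} → AllPairs _<_ l → v ∈ l → at l 0 ≤ v
increasing-head (_ ∷ _)  (here refl) = ≤-refl
increasing-head (x< ∷ _) (there v∈)  = <⇒≤ (All.lookup x< v∈)

at-increasing : ∀ l → (∀ {i} → suc i < length l → at l i < at l (suc i)) → AllPairs _<_ l
at-increasing l = Linked.Linked⇒AllPairs <-trans ∘ linked l
  where
  open import Data.List.Relation.Unary.Linked using (Linked; []; [-]; _∷_)
  linked : ∀ l → (∀ {i} → suc i < length l → at l i < at l (suc i)) → Linked _<_ l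
  linked []          h = []
  linked (x ∷ [])    h = [-]
  linked (x ∷ y ∷ l) h = h {0} (s≤s (s≤s z≤n)) ∷ linked (y ∷ l) (h ∘ s≤s)

module StrictlyMonotone (f : ℕ → ℕ) (mono : ∀ {x y} → x < y → f x < f y) where

  cancel : ∀ {x y} → f x < f y → x < y
  cancel {x} {y} fx<fy with <-cmp x y
  ... | tri< x<y _ _  = x<y
  ... | tri≈ _ refl _ = contradiction fx<fy (<-irrefl refl)
  ... | tri> _ _ y<x  = contradiction fx<fy (<⇒≯ (mono y<x))

  injective : ∀ {x y} → f x ≡ f y → x ≡ y
  injective {x} {y} eq with <-cmp x y
  ... | tri< x<y _ _ = contradiction eq (<⇒≢ (mono x<y))
  ... | tri≈ _ x≡y _ = x≡y
  ... | tri> _ _ y<x = contradiction (sym eq) (<⇒≢ (mono y<x))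

  at-map-< : ∀ {i j} l → i < length l → j < length l → at l i < at l j ⇔ at (map f l) i < at (map f l) j
  at-map-< l i< j< rewrite at-map f l i< | at-map f l j< = mk⇔ mono cancel

  -- A strictly monotone `f` preserves and reflects `<`, so relabelling by it neither creates nor
  -- destroys descents.
  pattern-map : ∀ {J} l → Pattern J l ⇔ Pattern J (map f l)
  pattern-map {J} l = mk⇔ forth back
    where
    forth : Pattern J l → Pattern J (map f l)
    forth p i<′ =
      let i< = subst (_ <_) (length-map f l) i<′
          e  = at-map-< l i< (<⇒≤ i<)
      in mk⇔ (to e ∘ to (p i<)) (from (p i<) ∘ from e)
    back : Pattern J (map f l) → Pattern J l
    back p i< =
      let i<′ = subst (_ <_) (sym (length-map f l)) i<
          e   = at-map-< l i< (<⇒≤ i<)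
      in mk⇔ (from e ∘ to (p i<′)) (from (p i<′) ∘ to e)

-- Deleting a letter from the alphabet

-- The increasing enumeration of ℕ ∖ {c}.
skip : ℕ → ℕ → ℕ
skip zero    v       = suc v
skip (suc c) zero    = zero
skip (suc c) (suc v) = suc (skip c v)

skip-mono : ∀ c {x y} → x < y → skip c x < skip c y
skip-mono zero    x<y                       = s≤s x<y
skip-mono (suc c) {zero}  {suc y} _         = s≤s z≤n
skip-mono (suc c) {suc x} {suc y} (s≤s x<y) = s≤s (skip-mono c x<y)

skip-fix : ∀ {c v} → v < c → skip c v ≡ v
skip-fix {suc c} {zero}  _         = refl
skip-fix {suc c} {suc v} (s≤s v<c) = cong suc (skip-fix v<c)

-- A left inverse of `skip c`. Its value at `c`, which `skip c` never takes, is a default (again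
-- `c`).
unskip : ℕ → ℕ → ℕ
unskip zero    v       = pred v
unskip (suc c) zero    = zero
unskip (suc c) (suc v) = suc (unskip c v)

unskip-skip : ∀ c v → unskip c (skip c v) ≡ v
unskip-skip zero    v       = refl
unskip-skip (suc c) zero    = refl
unskip-skip (suc c) (suc v) = cong suc (unskip-skip c v)

map-unskip-skip : ∀ c w → map (unskip c) (map (skip c) w) ≡ w
map-unskip-skip c w = trans (sym (map-∘ w)) (trans (map-cong (unskip-skip c) w) (map-id w))

skip-≢ : ∀ c v → skip c v ≢ c
skip-≢ (suc c) (suc v) eq = skip-≢ c v (suc-injective eq)

skip-onto : ∀ {c v} → v ≢ c → ∃[ u ] skip c u ≡ v
skip-onto {zero}  {zero}  v≢c = contradiction refl v≢c
skip-onto {zero}  {suc v} v≢c = v , refl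
skip-onto {suc c} {zero}  v≢c = zero , refl
skip-onto {suc c} {suc v} v≢c = let u , eq = skip-onto (v≢c ∘ cong suc) in suc u , cong suc eq

-- As `c` lies in [0, n], the numbers of [0, n] other than `c` are the first `n` values of `skip c`:
-- the alphabet changes by exactly one letter.
skip-< : ∀ {c n} → c ≤ n → ∀ {v} → v < n ⇔ skip c v < suc n
skip-< {zero}  _ = mk⇔ s≤s s≤s⁻¹
skip-< {suc c} {suc n} (s≤s c≤n) {zero}  = mk⇔ (λ _ → s≤s z≤n) (λ _ → s≤s z≤n)
skip-< {suc c} {suc n} (s≤s c≤n) {suc v} =
  mk⇔ (s≤s ∘ to (skip-< c≤n) ∘ s≤s⁻¹) (s≤s ∘ from (skip-< c≤n) ∘ s≤s⁻¹)

map-skip-onto : ∀ {c} w → c ∉ w → ∃[ u ] map (skip c) u ≡ w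
map-skip-onto []      c∉ = [] , refl
map-skip-onto (x ∷ w) c∉ =
  let u , eq = skip-onto (c∉ ∘ here ∘ sym)
      l , eqs = map-skip-onto w (c∉ ∘ there)
  in u ∷ l , cong₂ _∷_ eq eqs

-- Permutations with a given descent pattern

record Arrangement (J : Pred ℕ 0ℓ) (n : ℕ) (l : List ℕ) : Set where
  field
    length≡ : length l ≡ n
    bounded : All (_< n) l
    unique  : Unique l
    patt    : Pattern J l

-- The `n` letters are distinct and lie in [0, n), so by counting none is missing.
arrangement-full : ∀ {J n l} → Arrangement J n l → ∀ {v} → v < n → v ∈ l
arrangement-full {n = n} arr v<n = pigeonhole unique (Unique.upTo⁺ n) (∈-upTo⁺ ∘ All.lookup bounded)
  (trans length≡ (sym (length-upTo n))) (∈-upTo⁺ v<n)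
  where open Arrangement arr

-- The first letter is the largest at a descent, the smallest otherwise.
arrangement-exists : ∀ {J} → Decidable J → ∀ n → ∃ (Arrangement J n)
arrangement-exists J? zero = [] , record { length≡ = refl ; bounded = [] ; unique = [] ; patt = λ () }
arrangement-exists {J} J? (suc n) with arrangement-exists (J? ∘ suc) n | J? 0
... | l , arr | yes j = n ∷ l , record
  { length≡ = cong suc length≡
  ; bounded = ≤-refl ∷ All.map m<n⇒m<1+n bounded
  ; unique  = All.map (λ v<n n≡v → <⇒≢ v<n (sym n≡v)) bounded ∷ unique
  ; patt    = λ { {zero} (s≤s 0<) → mk⇔ (λ _ → All.lookup bounded (at-∈ l 0<)) (λ _ → j)
                ; {suc i} (s≤s i<) → patt i< }
  }
  where open Arrangement arr
... | l , arr | no ¬j = 0 ∷ map suc l , record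
  { length≡ = cong suc (trans (length-map suc l) length≡)
  ; bounded = s≤s z≤n ∷ All.map⁺ (All.map s≤s bounded)
  ; unique  = All.map⁺ (All.map (λ _ ()) bounded) ∷ Unique.map⁺ suc-injective unique
  ; patt    = λ { {zero} _ → mk⇔ (λ j → contradiction j ¬j) (λ ())
                ; {suc i} (s≤s i<) → to (pattern-map l) patt i< }
  }
  where
  open Arrangement arr
  open StrictlyMonotone suc s≤s

-- Binomial sums

sum-+ : ∀ f g n → sum (applyUpTo (λ k → f k + g k) n) ≡ sum (applyUpTo f n) + sum (applyUpTo g n)
sum-+ f g zero    = refl
sum-+ f g (suc n) = begin
  f 0 + g 0 + sum (applyUpTo (λ k → f (suc k) + g (suc k)) n) ≡⟨ cong (f 0 + g 0 +_) (sum-+ (f ∘ suc) (g ∘ suc) n) ⟩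
  f 0 + g 0 + (F + G)                                         ≡⟨ interchange (f 0) (g 0) F G ⟩
  f 0 + F + (g 0 + G)                                         ∎
  where
  open ≡-Reasoning
  open +-*-Solver
  F = sum (applyUpTo (f ∘ suc) n)
  G = sum (applyUpTo (g ∘ suc) n)
  interchange = solve 4 (λ a b c d → a :+ b :+ (c :+ d) := a :+ c :+ (b :+ d)) refl

sum-cong : ∀ {f g : ℕ → ℕ} → f ≗ g → ∀ n → sum (applyUpTo f n) ≡ sum (applyUpTo g n)
sum-cong f≗g zero    = refl
sum-cong f≗g (suc n) = cong₂ _+_ (f≗g 0) (sum-cong (f≗g ∘ suc) n)

binomialSum : ℕ → (ℕ → ℕ) → ℕ → ℕ
binomialSum M b N = ∑₀ M (λ k → b k * (N C k))

binomialSum-0ˡ : ∀ b N → binomialSum 0 b N ≡ b 0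
binomialSum-0ˡ b N = trans (+-identityʳ _) (*-identityʳ (b 0))

-- `0 C k` vanishes for k ≥ 1, so only the term k = 0 survives.
binomialSum-0ʳ : ∀ M b → binomialSum M b 0 ≡ b 0
binomialSum-0ʳ M b = trans (cong₂ _+_ (*-identityʳ (b 0)) (vanish M {b ∘ suc})) (+-identityʳ (b 0))
  where
  vanish : ∀ M {b : ℕ → ℕ} → sum (applyUpTo (λ k → b k * 0) M) ≡ 0
  vanish zero        = refl
  vanish (suc M) {b} = cong₂ _+_ (*-zeroʳ (b 0)) (vanish M {b ∘ suc})

-- Pascal's rule in every term with k ≥ 1. The shift `b ∘ suc` matches the passage from `Filling j`
-- to `Filling (suc j)` in the recursion for prefixes.
binomialSum-pascal : ∀ M b N → binomialSum (suc M) b (suc N) ≡ binomialSum (suc M) b N + binomialSum M (b ∘ suc) N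
binomialSum-pascal M b N = begin
  b 0 * 1 + ∑₀ M (λ k → b (suc k) * (suc N C suc k))                            ≡⟨ cong (b 0 * 1 +_) (sum-cong pascal (suc M)) ⟩
  b 0 * 1 + ∑₀ M (λ k → b (suc k) * (N C suc k) + b (suc k) * (N C k))          ≡⟨ cong (b 0 * 1 +_) (sum-+ (λ k → b (suc k) * (N C suc k)) (λ k → b (suc k) * (N C k)) (suc M)) ⟩
  b 0 * 1 + (∑₀ M (λ k → b (suc k) * (N C suc k)) + binomialSum M (b ∘ suc) N)  ≡⟨ +-assoc (b 0 * 1) _ _ ⟨
  binomialSum (suc M) b N + binomialSum M (b ∘ suc) N                           ∎
  where
  open ≡-Reasoning
  pascal : ∀ k → b (suc k) * (suc N C suc k) ≡ b (suc k) * (N C suc k) + b (suc k) * (N C k)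
  pascal k = begin
    b (suc k) * (suc N C suc k)                     ≡⟨ cong (b (suc k) *_) (nCk+nC[k+1]≡[n+1]C[k+1] N k) ⟨
    b (suc k) * (N C k + N C suc k)                 ≡⟨ cong (b (suc k) *_) (+-comm (N C k) _) ⟩
    b (suc k) * (N C suc k + N C k)                 ≡⟨ *-distribˡ-+ (b (suc k)) _ _ ⟩
    b (suc k) * (N C suc k) + b (suc k) * (N C k)   ∎

-- Prefixes and the recursion for their number

module Prefixes (m : ℕ) (0<m : 0 < m) (J : Pred ℕ 0ℓ) where

  last : List ℕ → ℕ
  last w = at w (pred m)

  suc-pred-m : suc (pred m) ≡ m
  suc-pred-m = suc-pred m {{>-nonZero 0<m}}

  pred-m<m : pred m < m
  pred-m<m = ≤-reflexive suc-pred-m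

  -- The initial segments π₁ ⋯ πₘ of the arrangements of [0 , n) whose last descent is at m.
  -- gap is the descent at m, since πₘ₊₁ is the least letter missing from the prefix.
  record Prefix (n : ℕ) (w : List ℕ) : Set where
    field
      length≡ : length w ≡ m
      bounded : All (_< n) w
      unique  : Unique w
      patt    : Pattern J w
      gap     : ∃[ v ] v < m × v ∉ w × v < last w

  -- The alphabet splits into `m` small letters, `j` forced letters and `N` free ones. Letters are
  -- 0-based, so `m + i` for i < j are the letters m + 1, ..., m + j; f j N is the size of this set.
  Filling : ℕ → ℕ → Pred (List ℕ) 0ℓ
  Filling j N w = Prefix (m + j + N) w × (∀ {i} → i < j → m + i ∈ w)

  last-map : ∀ f {w} → length w ≡ m → last (map f w) ≡ f (last w)
  last-map f {w} eq = at-map f w (subst (pred m <_) (sym eq) pred-m<m)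

  last-∈ : ∀ {w} → length w ≡ m → last w ∈ w
  last-∈ {w} eq = at-∈ w (subst (pred m <_) (sym eq) pred-m<m)

  module _ (j N : ℕ) where

    private
      -- The first free letter, m + j + 1 in 1-based terms.
      c = m + j
      σ = skip c
      open module Skip = StrictlyMonotone σ (skip-mono c)

      bound : ∀ {v} → v < c + N ⇔ σ v < c + suc N
      bound {v} = subst (λ b → v < c + N ⇔ σ v < b) (sym (+-suc c N)) (skip-< (m≤m+n c N))

      fix : ∀ {i} → i < j → σ (m + i) ≡ m + i
      fix i<j = skip-fix (+-monoʳ-< m i<j)

      fix-m : ∀ {v} → v < m → σ v ≡ v
      fix-m v<m = skip-fix (≤-trans v<m (m≤m+n m j))

      ∈-map⁻′ : ∀ {v w} → σ v ∈ map σ w → v ∈ w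
      ∈-map⁻′ v∈ = let u , u∈ , eq = ∈-map⁻ σ v∈ in subst (_∈ _) (sym (injective eq)) u∈

    -- All letters below `m + j` are fixed by `σ`, hence the forced letters stay in place and the
    -- missing small letter of `gap` stays missing.
    insert-letter : ∀ {w} → Filling j N w → Filling j (suc N) (map σ w) × m + j ∉ map σ w
    insert-letter {w} (p , full) = (record
      { length≡ = trans (length-map σ w) length≡
      ; bounded = All.map⁺ (All.map (to bound) bounded)
      ; unique  = Unique.map⁺ injective unique
      ; patt    = to (pattern-map w) patt
      ; gap     = let v , v<m , v∉ , v<last = gap in
                  σ v , subst (_< m) (sym (fix-m v<m)) v<m , v∉ ∘ ∈-map⁻′ ,
                  subst (σ v <_) (sym (last-map σ {w} length≡)) (skip-mono c v<last)
      } , (λ i<j → subst (_∈ map σ w) (fix i<j) (∈-map⁺ σ (full i<j)))) ,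
      λ c∈ → let u , _ , eq = ∈-map⁻ σ c∈ in skip-≢ c u (sym eq)
      where open Prefix p

    -- The letter of `gap` is below `m`, so it is not the deleted one and keeps its name; the same
    -- letter serves after deletion.
    delete-letter : ∀ {w} → Filling j (suc N) (map σ w) → Filling j N w
    delete-letter {w} (p , full) = record
      { length≡ = length-w
      ; bounded = All.map (from bound) (All.map⁻ bounded)
      ; unique  = Unique.map⁻ unique
      ; patt    = from (pattern-map w) patt
      ; gap     = let v , v<m , v∉ , v<last = gap in
                  v , v<m , (λ v∈ → v∉ (subst (_∈ map σ w) (fix-m v<m) (∈-map⁺ σ v∈))) ,
                  cancel (subst₂ _<_ (sym (fix-m v<m)) (last-map σ {w} length-w) v<last)
      } , λ i<j → ∈-map⁻′ (subst (_∈ map σ w) (sym (fix i<j)) (full i<j))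
      where
      open Prefix p
      length-w : length w ≡ m
      length-w = trans (sym (length-map σ w)) length≡

    -- Every word avoiding `m + j` is an image under `map σ`, and on such words `map (unskip c)` is
    -- inverse to `map σ`.
    size-avoiding : ∀ {s} → HasSize (λ w → Filling j (suc N) w × m + j ∉ w) s → HasSize (Filling j N) s
    size-avoiding = size-bijection (map (unskip c)) maps inj
      (λ {w} q → map σ w , insert-letter q , map-unskip-skip c w)
      where
      maps : ∀ {w} → Filling j (suc N) w × m + j ∉ w → Filling j N (map (unskip c) w)
      maps {w} (q , c∉) with u , refl ← map-skip-onto w c∉ =
        subst (Filling j N) (sym (map-unskip-skip c u)) (delete-letter q)
      inj : ∀ {w w′} → Filling j (suc N) w × m + j ∉ w → Filling j (suc N) w′ × m + j ∉ w′ →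
            map (unskip c) w ≡ map (unskip c) w′ → w ≡ w′
      inj {w} {w′} (_ , c∉) (_ , c∉′) eq
        with u , refl ← map-skip-onto w c∉ | u′ , refl ← map-skip-onto w′ c∉′ =
        cong (map σ) (trans (sym (map-unskip-skip c u)) (trans eq (map-unskip-skip c u′)))

    -- The alphabet is unchanged; its first free letter is now counted as forced.
    containing : ∀ {w} → (Filling j (suc N) w × m + j ∈ w) ⇔ Filling (suc j) N w
    containing {w} = mk⇔
      (λ ((p , full) , c∈) → subst (λ n → Prefix n w) eq p ,
        λ i<1+j → [ full , (λ { refl → c∈ }) ]′ (m≤n⇒m<n∨m≡n (s≤s⁻¹ i<1+j)))
      (λ (p , full) → (subst (λ n → Prefix n w) (sym eq) p , full ∘ m<n⇒m<1+n) , full ≤-refl)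
      where
      eq : m + j + suc N ≡ m + suc j + N
      eq = trans (+-suc (m + j) N) (cong (_+ N) (sym (+-suc m j)))

  size-containing : ∀ j N {s} → HasSize (λ w → Filling j (suc N) w × m + j ∈ w) s → HasSize (Filling (suc j) N) s
  size-containing j N = size-cong (containing j N)

  -- The `j` forced letters are distinct and would have to fit into `m` places.
  Filling-overfull : ∀ {j N} → m < j → Empty (Filling j N)
  Filling-overfull {j} m<j w (p , full) = <⇒≱ m<j (begin
    j                            ≡⟨ length-applyUpTo (m +_) j ⟨
    length (applyUpTo (m +_) j)  ≤⟨ length-mono-⊆ distinct unique contained ⟩
    length w                     ≡⟨ length≡ ⟩
    m                            ∎)
    where
    open Prefix p
    open ≤-Reasoning
    distinct : Unique (applyUpTo (m +_) j)
    distinct = Unique.applyUpTo⁺₁ (m +_) j (λ i<k _ → <⇒≢ (+-monoʳ-< m i<k))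
    contained : ∀ {v} → v ∈ applyUpTo (m +_) j → v ∈ w
    contained v∈ = let i , i<j , eq = ∈-applyUpTo⁻ (m +_) v∈ in subst (_∈ w) (sym eq) (full i<j)

  -- Induction on `N` for all `j` at once. `M` is the number of places that the forced letters leave
  -- over, and `b k` counts the prefixes with `k` further forced letters and no free ones.
  size-Filling : ∀ N M j {b : ℕ → ℕ} → j + M ≡ m → (∀ {k} → k ≤ M → HasSize (Filling (j + k) 0) (b k)) →
                 ∀ {s} → HasSize (Filling j N) s → s ≡ binomialSum M b N
  size-Filling zero M j {b} j+M≡m sizes size-s =
    trans (size-unique size-s (subst (λ j → HasSize (Filling j 0) (b 0)) (+-identityʳ j) (sizes z≤n)))
          (sym (binomialSum-0ʳ M b))
  size-Filling (suc N) M j {b} j+M≡m sizes size-s with size-split (λ w → _∈?_ _≟_ (m + j) w) size-s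
  ... | s₁ , s₂ , avoid , contain , refl = split M j+M≡m sizes
    where
    open ≡-Reasoning
    size₁ : HasSize (Filling j N) s₁
    size₁ = size-avoiding j N avoid
    split : ∀ M → j + M ≡ m → (∀ {k} → k ≤ M → HasSize (Filling (j + k) 0) (b k)) →
            s₁ + s₂ ≡ binomialSum M b (suc N)
    -- Here j = m: the forced letters fill every place, so no prefix contains `m + j` as well.
    split zero eq sizes = begin
      s₁ + s₂              ≡⟨ cong₂ _+_ (size-Filling N 0 j eq sizes size₁) s₂≡0 ⟩
      binomialSum 0 b N + 0 ≡⟨ +-identityʳ _ ⟩
      binomialSum 0 b N     ≡⟨ binomialSum-0ˡ b N ⟩
      b 0                   ≡⟨ binomialSum-0ˡ b (suc N) ⟨
      binomialSum 0 b (suc N) ∎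
      where
      s₂≡0 : s₂ ≡ 0
      s₂≡0 = size-unique (size-containing j N contain)
        (size-empty (Filling-overfull (≤-reflexive (cong suc (trans (sym eq) (+-identityʳ j))))))
    split (suc M) eq sizes = begin
      s₁ + s₂                                              ≡⟨ cong₂ _+_ (size-Filling N (suc M) j eq sizes size₁)
                                                                (size-Filling N M (suc j) (trans (sym (+-suc j M)) eq) sizes′ (size-containing j N contain)) ⟩
      binomialSum (suc M) b N + binomialSum M (b ∘ suc) N  ≡⟨ binomialSum-pascal M b N ⟨
      binomialSum (suc M) b (suc N)                        ∎
      where
      sizes′ : ∀ {k} → k ≤ M → HasSize (Filling (suc j + k) 0) (b (suc k))
      sizes′ {k} k≤M = subst (λ j → HasSize (Filling j 0) (b (suc k))) (+-suc j k) (sizes (s≤s k≤M))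

  -- Recovering a permutation from its prefix

  complement : ℕ → List ℕ → List ℕ
  complement n w = filter (λ v → ¬? (_∈?_ _≟_ v w)) (upTo n)

  ∈-complement : ∀ {n w v} → v ∈ complement n w ⇔ (v < n × v ∉ w)
  ∈-complement {n} {w} = mk⇔
    (λ v∈ → let v∈′ , v∉ = ∈-filter⁻ _ {xs = upTo n} v∈ in ∈-upTo⁻ v∈′ , v∉)
    (λ (v<n , v∉) → ∈-filter⁺ _ (∈-upTo⁺ v<n) v∉)

  complement-increasing : ∀ n w → AllPairs _<_ (complement n w)
  complement-increasing n w = AllPairs.filter⁺ _ (AllPairs.applyUpTo⁺₁ id n (λ i<j _ → i<j))

  module _ (J-last : J (pred m)) (J-< : ∀ {i} → J i → i < m) where

    module _ {n : ℕ} {w t : List ℕ} (|w| : length w ≡ m) (arr : Arrangement J n (w ++ t)) (m<n : m < n) where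

      open Arrangement arr

      private
        |w|+|t| : length w + length t ≡ n
        |w|+|t| = trans (sym (length-++ w)) length≡

        0<|t| : 0 < length t
        0<|t| = +-cancelˡ-< (length w) 0 (length t)
          (subst₂ _<_ (sym (trans (+-identityʳ _) |w|)) (sym |w|+|t|) m<n)

        disjoint : ∀ {v} → v ∈ t → v ∉ w
        disjoint v∈t v∈w = ++-disjoint w unique v∈w v∈t

      -- `J` holds at no 0-based position from `m` on, so no step of the tail is a descent, and
      -- distinctness makes each an ascent.
      tail-increasing : AllPairs _<_ t
      tail-increasing = at-increasing t λ {i} i< →
        let k    = length w + i
            k<   : suc k < length (w ++ t)
            k<   = subst₂ _<_ (+-suc (length w) i) (sym (length-++ w)) (+-monoʳ-< (length w) i<)
            no-J : ¬ J k
            no-J j = <⇒≱ (J-< j) (subst (_≤ k) |w| (m≤m+n (length w) i))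
            ≤at  = ≮⇒≥ (no-J ∘ from (patt k<))
        in subst₂ _<_ (at-++ʳ w t i) (trans (cong (at (w ++ t)) (sym (+-suc (length w) i))) (at-++ʳ w t (suc i)))
             (≤∧≢⇒< ≤at (at-distinct unique k<))

      -- Both lists are increasing, and since every letter of [0, n) occurs in `w ++ t`, they have
      -- the same members.
      tail-complement : t ≡ complement n w
      tail-complement = increasing-≡ tail-increasing (complement-increasing n w) (mk⇔
        (λ v∈t → from ∈-complement (All.lookup bounded (∈-++⁺ʳ w v∈t) , disjoint v∈t))
        (λ v∈ → let v<n , v∉w = to ∈-complement v∈ in
          [ (λ v∈w → contradiction v∈w v∉w) , id ]′ (∈-++⁻ w (arrangement-full arr v<n))))

      -- The witness for `gap` is πₘ₊₁, the first letter of the tail.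
      prefix-of : Prefix n w
      prefix-of = record
        { length≡ = |w|
        ; bounded = All.++⁻ˡ w bounded
        ; unique  = unique-w
        ; patt    = patt-w
        ; gap     = at t 0 , first<m , disjoint (at-∈ t 0<|t|) , descent
        }
        where
        unique-w : Unique w
        unique-w = unique-++⁻ˡ w unique
        patt-w : Pattern J w
        patt-w {i} i< = subst₂ (λ x y → J i ⇔ x < y) (at-++ˡ w t i<) (at-++ˡ w t (<⇒≤ i<))
          (patt (≤-trans i< (length-++-≤ˡ w)))
        descent : at t 0 < last w
        descent = subst₂ _<_
          (trans (cong (at (w ++ t)) (trans suc-pred-m (trans (sym |w|) (sym (+-identityʳ _))))) (at-++ʳ w t 0))
          (at-++ˡ w t (subst (pred m <_) (sym |w|) pred-m<m))
          (to (patt (subst₂ _<_ (sym suc-pred-m) (sym length≡) m<n)) J-last)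
        -- Otherwise w would be a permutation of [0 , m), leaving no descent at m.
        first<m : at t 0 < m
        first<m with at t 0 <? m
        ... | yes lt = lt
        ... | no ≮m  = contradiction descent (≤⇒≯ (≤-trans (<⇒≤ last<m) (≮⇒≥ ≮m)))
          where
          small∈w : ∀ {u} → u ∈ upTo m → u ∈ w
          small∈w u∈ with ∈-++⁻ w (arrangement-full arr (<-trans (∈-upTo⁻ u∈) m<n))
          ... | inj₁ u∈w = u∈w
          ... | inj₂ u∈t = contradiction (<-≤-trans (∈-upTo⁻ u∈) (≮⇒≥ ≮m)) (≤⇒≯ (increasing-head tail-increasing u∈t))
          last<m : last w < m
          last<m = ∈-upTo⁻ (pigeonhole (Unique.upTo⁺ m) unique-w small∈w
            (trans (length-upTo m) (sym |w|)) (last-∈ {w} |w|))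

    -- The descent at `m` comes from `gap`: the complement begins with the least missing letter,
    -- which is at most the letter of `gap` and so below `last w`.
    extend : ∀ {n w} → m < n → Prefix n w → Arrangement J n (w ++ complement n w)
    extend {n} {w} m<n p = record
      { length≡ = length-all
      ; bounded = All.tabulate (∈-upTo⁻ ∘ to same)
      ; unique  = unique-all
      ; patt    = pattern-all
      }
      where
      open Prefix p
      t = complement n w
      increasing : AllPairs _<_ t
      increasing = complement-increasing n w
      same : ∀ {v} → v ∈ w ++ t ⇔ v ∈ upTo n
      same = mk⇔ (λ v∈ → [ ∈-upTo⁺ ∘ All.lookup bounded , ∈-upTo⁺ ∘ proj₁ ∘ to ∈-complement ]′ (∈-++⁻ w v∈)) back
        where
        back : ∀ {v} → v ∈ upTo n → v ∈ w ++ t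
        back {v} v∈ with _∈?_ _≟_ v w
        ... | yes v∈w = ∈-++⁺ˡ v∈w
        ... | no  v∉w = ∈-++⁺ʳ w (from ∈-complement (∈-upTo⁻ v∈ , v∉w))
      unique-all : Unique (w ++ t)
      unique-all = Unique.++⁺ unique (increasing⇒unique increasing)
        (λ (v∈w , v∈t) → proj₂ (to (∈-complement {n}) v∈t) v∈w)
      length-all : length (w ++ t) ≡ n
      length-all = trans (↭-length (unique-↭ unique-all (Unique.upTo⁺ n) same)) (length-upTo n)
      first<last : at t 0 < last w
      first<last = let v , v<m , v∉w , v<last = gap in
        ≤-<-trans (increasing-head increasing (from (∈-complement {n}) (<-trans v<m m<n , v∉w))) v<last
      pattern-all : Pattern J (w ++ t)
      -- The 0-based positions `i` and `suc i` lie inside the prefix, straddle its end, or lie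
      -- inside the increasing tail.
      pattern-all {i} i< with <-cmp (suc i) m
      ... | tri< 1+i<m _ _ = subst₂ (λ x y → J i ⇔ x < y) (sym (at-++ˡ w t 1+i<)) (sym (at-++ˡ w t (<⇒≤ 1+i<))) (patt 1+i<)
        where
        1+i< : suc i < length w
        1+i< = subst (suc i <_) (sym length≡) 1+i<m
      ... | tri≈ _ refl _ = mk⇔ (λ _ → subst₂ _<_
              (sym (trans (cong (at (w ++ t)) (trans (sym length≡) (sym (+-identityʳ _)))) (at-++ʳ w t 0)))
              (sym (at-++ˡ w t (≤-reflexive (sym length≡)))) first<last)
            (λ _ → J-last)
      ... | tri> _ _ m<1+i = mk⇔ (λ j → contradiction (J-< j) (≤⇒≯ (s≤s⁻¹ m<1+i)))
            (λ desc → contradiction desc (<⇒≯ ascent))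
        where
        k = i ∸ length w
        k+ : i ≡ length w + k
        k+ = sym (m+[n∸m]≡n (subst (_≤ i) (sym length≡) (s≤s⁻¹ m<1+i)))
        suc-k+ : suc i ≡ length w + suc k
        suc-k+ = trans (cong suc k+) (sym (+-suc (length w) k))
        ascent : at (w ++ t) i < at (w ++ t) (suc i)
        ascent = subst₂ _<_
          (sym (trans (cong (at (w ++ t)) k+) (at-++ʳ w t k)))
          (sym (trans (cong (at (w ++ t)) suc-k+) (at-++ʳ w t (suc k))))
          (increasing-at increasing
            (+-cancelˡ-< (length w) _ _ (subst₂ _<_ suc-k+ (length-++ w) i<)))

    -- The shifted letters are k, ..., m + k - 1. They include m, ..., m + k - 1 because k ≤ m, and
    -- they omit 0 because k > 0, which gives `gap`.
    Filling-nonempty : Decidable J → ∀ k → 0 < k → k ≤ m → ∃ (Filling k 0)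
    Filling-nonempty J? k 0<k k≤m with l , arr ← arrangement-exists J? m =
      map (k +_) l , record
        { length≡ = trans (length-map (k +_) l) length≡
        ; bounded = All.map⁺ (All.map bound bounded)
        ; unique  = Unique.map⁺ (+-cancelˡ-≡ k _ _) unique
        ; patt    = to (StrictlyMonotone.pattern-map (k +_) (+-monoʳ-< k) l) patt
        ; gap     = 0 , 0<m , 0∉ , subst (0 <_) (sym (last-map (k +_) {l} length≡)) (≤-trans 0<k (m≤m+n k _))
        -- The letter `m + i` is the shift of `m ∸ k + i`, which is below `m` as i < k.
        } , λ {i} i<k → subst (_∈ map (k +_) l) (shift i) (∈-map⁺ (k +_) (arrangement-full arr (small i<k)))
      where
      open Arrangement arr
      bound : ∀ {v} → v < m → k + v < m + k + 0
      bound {v} v<m = subst (k + v <_) (trans (+-comm k m) (sym (+-identityʳ _))) (+-monoʳ-< k v<m)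
      0∉ : 0 ∉ map (k +_) l
      0∉ 0∈ = let v , _ , eq = ∈-map⁻ (k +_) 0∈ in <⇒≢ (≤-trans 0<k (m≤m+n k v)) eq
      shift : ∀ i → k + (m ∸ k + i) ≡ m + i
      shift i = trans (sym (+-assoc k (m ∸ k) i)) (cong (_+ i) (m+[n∸m]≡n k≤m))
      small : ∀ {i} → i < k → m ∸ k + i < m
      small {i} i<k = subst (m ∸ k + i <_) (m∸n+n≡m k≤m) (+-monoʳ-< (m ∸ k) i<k)

  -- The prefixes counted by aₖ(I)

  -- The condition that the letters of the prefix in [m + 1, 2m] form [m + 1, m + k], in 0-based
  -- letters.
  Top : ℕ → Pred (List ℕ) 0ℓ
  Top k w = ∀ u → m ≤ u → u < 2 * m → u ∈ w ⇔ u < m + k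

  -- `Top k` excludes all letters from `m + k` up to `2 * m`, so the alphabet can be cut down to [0,
  -- m + k), with no free letter left.
  Prefix-Top⇔Filling : ∀ {k w} → k ≤ m → (Prefix (2 * m) w × Top k w) ⇔ Filling k 0 w
  Prefix-Top⇔Filling {k} {w} k≤m = mk⇔ forth back
    where
    m+k≤2m : m + k ≤ 2 * m
    m+k≤2m = +-monoʳ-≤ m (≤-trans k≤m (≤-reflexive (sym (+-identityʳ m))))
    forth : Prefix (2 * m) w × Top k w → Filling k 0 w
    forth (p , top) = record
      { length≡ = length≡ ; unique = unique ; patt = patt ; gap = gap
      ; bounded = All.tabulate λ {v} v∈ → subst (v <_) (sym (+-identityʳ _)) (bound v∈ (<-≤-connex v m))
      } , λ {i} i<k → from (top _ (m≤m+n m i) (<-≤-trans (+-monoʳ-< m i<k) m+k≤2m)) (+-monoʳ-< m i<k)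
      where
      open Prefix p
      bound : ∀ {v} → v ∈ w → v < m ⊎ m ≤ v → v < m + k
      bound v∈ (inj₁ v<m) = <-≤-trans v<m (m≤m+n m k)
      bound v∈ (inj₂ m≤v) = to (top _ m≤v (All.lookup bounded v∈)) v∈
    back : Filling k 0 w → Prefix (2 * m) w × Top k w
    back (p , full) = record
      { length≡ = length≡ ; unique = unique ; patt = patt ; gap = gap
      ; bounded = All.map (λ v< → <-≤-trans v< (subst (_≤ 2 * m) (sym (+-identityʳ _)) m+k≤2m)) bounded
      } , λ u m≤u _ → mk⇔
        (λ u∈ → subst (u <_) (+-identityʳ _) (All.lookup bounded u∈))
        (λ u<m+k → subst (_∈ w) (m+[n∸m]≡n m≤u)
          (full (+-cancelˡ-< m _ _ (subst (_< m + k) (sym (m+[n∸m]≡n m≤u)) u<m+k))))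
      where open Prefix p

  -- A prefix over [0, m) uses all `m` letters and leaves none for `gap`; this is why a₀(I) = 0.
  Filling-0 : Empty (Filling 0 0)
  Filling-0 w (p , _) = let v , v<m , v∉w , _ = gap in
    v∉w (pigeonhole unique (Unique.upTo⁺ m)
      (λ {u} u∈ → ∈-upTo⁺ (subst (u <_) (trans (+-identityʳ _) (+-identityʳ m)) (All.lookup bounded u∈)))
      (trans length≡ (sym (length-upTo m))) (∈-upTo⁺ v<m))
    where open Prefix p

-- One-line notation as a list of letters

word : ∀ {k n} → Vec (Fin k) n → List ℕ
word π = map toℕ (toList π)

length-word : ∀ {k n} (π : Vec (Fin k) n) → length (word π) ≡ n
length-word []      = refl
length-word (x ∷ π) = cong suc (length-word π)

word-bounded : ∀ {k n} (π : Vec (Fin k) n) → All (_< k) (word π)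
word-bounded []      = []
word-bounded (x ∷ π) = toℕ<n x ∷ word-bounded π

word-injective : ∀ {k n} {π ρ : Vec (Fin k) n} → word π ≡ word ρ → π ≡ ρ
word-injective {π = []}    {[]}    _  = refl
word-injective {π = x ∷ π} {y ∷ ρ} eq =
  let x≡y , π≡ρ = ∷-injective eq in cong₂ _∷_ (toℕ-injective x≡y) (word-injective π≡ρ)

word-onto : ∀ {k l} → All (_< k) l → ∃[ π ] word {k} {length l} π ≡ l
word-onto []        = [] , refl
word-onto (x< ∷ l<) = let π , eq = word-onto l< in fromℕ< x< ∷ π , cong₂ _∷_ (toℕ-fromℕ< x<) eq

word-unique : ∀ {k n} {π : Vec (Fin k) n} → VecUnique.Unique π ⇔ Unique (word π)
word-unique = mk⇔ forth back
  where
  forth : ∀ {n} {π : Vec _ n} → VecUnique.Unique π → Unique (word π)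
  forth VecAllPairs.[]        = []
  forth (x∉ VecAllPairs.∷ u) = All.map⁺ (All.map (_∘ toℕ-injective) (VecAll.toList⁺ x∉)) ∷ forth u
  back : ∀ {n} {π : Vec _ n} → Unique (word π) → VecUnique.Unique π
  back {π = []}    []        = VecAllPairs.[]
  back {π = x ∷ π} (x∉ ∷ u) = VecAll.toList⁻ (All.map (_∘ cong toℕ) (All.map⁻ x∉)) VecAllPairs.∷ back u

at-word : ∀ {k n} (π : Vec (Fin k) n) p → at (word π) (toℕ p) ≡ toℕ (Vec.lookup π p)
at-word (x ∷ π) zero    = refl
at-word (x ∷ π) (suc p) = at-word π p

at-word-fromℕ< : ∀ {k n i} (π : Vec (Fin k) n) (i<n : i < n) → at (word π) i ≡ toℕ (Vec.lookup π (fromℕ< i<n))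
at-word-fromℕ< π i<n = trans (cong (at (word π)) (sym (toℕ-fromℕ< i<n))) (at-word π (fromℕ< i<n))

Des-suc : ∀ {n i} (π : Vec (Fin n) n) → Des π (suc i) ⇔ (suc i < n × at (word π) (suc i) < at (word π) i)
Des-suc {n} {i} π = mk⇔ forth back
  where
  forth : Des π (suc i) → suc i < n × at (word π) (suc i) < at (word π) i
  forth (p , q , refl , eq , desc) = subst (_< n) eq (toℕ<n q) ,
    subst₂ _<_ (trans (sym (at-word π q)) (cong (at (word π)) eq)) (sym (at-word π p)) desc
  back : suc i < n × at (word π) (suc i) < at (word π) i → Des π (suc i)
  back (1+i<n , desc) = fromℕ< (<⇒≤ 1+i<n) , fromℕ< 1+i<n ,
    cong suc (toℕ-fromℕ< (<⇒≤ 1+i<n)) , toℕ-fromℕ< 1+i<n ,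
    subst₂ _<_ (at-word-fromℕ< π 1+i<n) (at-word-fromℕ< π (<⇒≤ 1+i<n)) desc

FirstLetters-suc : ∀ {n m u} {π : Vec (Fin n) n} → FirstLetters m π (suc u) ⇔ u ∈ take m (word π)
FirstLetters-suc = mk⇔
  (λ (p , p<m , eq) → subst (_∈ _) (suc-injective eq) (forth _ p p<m))
  (λ u∈ → let p , p<m , eq = back _ _ u∈ in p , p<m , cong suc eq)
  where
  forth : ∀ {k n m} (π : Vec (Fin k) n) p → toℕ p < m → toℕ (Vec.lookup π p) ∈ take m (word π)
  forth {m = suc m} (x ∷ π) zero    _         = here refl
  forth {m = suc m} (x ∷ π) (suc p) (s≤s p<m) = there (forth π p p<m)
  back : ∀ {k n u} m (π : Vec (Fin k) n) → u ∈ take m (word π) → ∃[ p ] toℕ p < m × toℕ (Vec.lookup π p) ≡ u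
  back (suc m) (x ∷ π) (here refl) = zero , s≤s z≤n , refl
  back (suc m) (x ∷ π) (there u∈)  = let p , p<m , eq = back m π u∈ in suc p , s≤s p<m , eq

∈-words : ∀ {k n} (π : Vec (Fin k) n) → π ∈ words k n
∈-words []      = here refl
∈-words (x ∷ π) = ∈-cartesianProductWith⁺ _∷_ (∈-allFin x) (∈-words π)

words-unique : ∀ k n → Unique (words k n)
words-unique k zero    = [] ∷ []
words-unique k (suc n) = Unique.cartesianProductWith⁺ _∷_ Vec.∷-injective (Unique.allFin⁺ k) (words-unique k n)

size-count : ∀ n {P : Pred (Vec (Fin n) n) 0ℓ} (P? : Decidable P) →
             HasSize (VecUnique.Unique ∩ P) (count n P?)
size-count n P? = size-filter P? (Unique.filter⁺ unique? (words-unique n n))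
  (mk⇔ (proj₂ ∘ ∈-filter⁻ unique? {xs = words n n}) (∈-filter⁺ unique? (∈-words _)))

-- Permutations with descent set I

module DescentSet (I : List ℕ) (I≢[] : I ≢ []) (I>0 : ∀ {i} → i ∈ I → 0 < i) where

  m = maxI I

  ∈I⇒≤m : ∀ {i} → i ∈ I → i ≤ m
  ∈I⇒≤m = All.lookup (xs≤max 0 I)

  0<m : 0 < m
  0<m = positive I I≢[] I>0
    where
    positive : ∀ I → I ≢ [] → (∀ {i} → i ∈ I → 0 < i) → 0 < maxI I
    positive []         I≢[] _   = contradiction refl I≢[]
    positive I@(i ∷ _) _     I>0 = <-≤-trans (I>0 (here refl)) (All.lookup (xs≤max 0 I) (here refl))

  -- A maximum over `I` with default 0 is 0 or a member of `I`, and `0<m` excludes the former.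
  m∈I : m ∈ I
  m∈I with argmax-sel id 0 I
  ... | inj₁ m≡0 = contradiction (sym m≡0) (<⇒≢ 0<m)
  ... | inj₂ m∈  = m∈

  -- `I` lowered by one, to match the 0-based positions of `Pattern`.
  J : Pred ℕ 0ℓ
  J i = suc i ∈ I

  J-last : J (pred m)
  J-last = subst (_∈ I) (sym (suc-pred m {{>-nonZero 0<m}})) m∈I

  open Prefixes m 0<m J

  -- `Pattern` only speaks of positions inside the word; as every element of `I` is positive and at
  -- most m < n, all of `I` is seen by it.
  HasDes⇔Arrangement : ∀ {n} {π : Vec (Fin n) n} → m < n →
                       (VecUnique.Unique π × HasDes I π) ⇔ Arrangement J n (word π)
  HasDes⇔Arrangement {n} {π} m<n = mk⇔
    (λ (u , ⊆I , I⊆) → record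
      { length≡ = length-word π
      ; bounded = word-bounded π
      ; unique  = to word-unique u
      ; patt    = λ i< → mk⇔ (proj₂ ∘ to (Des-suc π) ∘ I⊆)
                             (λ desc → ⊆I (from (Des-suc π) (subst (_ <_) (length-word π) i< , desc)))
      })
    (λ arr → let open Arrangement arr in from word-unique unique , (λ {_} → des⊆I arr) , λ {_} → I⊆des arr)
    where
    des⊆I : Arrangement J n (word π) → ∀ {i} → Des π i → i ∈ I
    des⊆I arr des@(p , _ , refl , _) =
      let i<n , desc = to (Des-suc π) des in
      from (Arrangement.patt arr (subst (_ <_) (sym (length-word π)) i<n)) desc
    I⊆des : Arrangement J n (word π) → ∀ {i} → i ∈ I → Des π i
    I⊆des arr {zero}  0∈I = contradiction (I>0 0∈I) (<-irrefl refl)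
    I⊆des arr {suc i} i∈I =
      let i<n = ≤-<-trans (∈I⇒≤m i∈I) m<n in
      from (Des-suc π) (i<n , to (Arrangement.patt arr (subst (_ <_) (sym (length-word π)) i<n)) i∈I)

  -- Taking the first `m` letters is a bijection, since the rest is the increasing complement. `R`
  -- is a further condition on the prefix: trivial for `d`, and `Top k` for `a k`.
  size-prefixes : ∀ {n c} {R : Pred (List ℕ) 0ℓ} → m < n →
                  HasSize (λ (π : Vec (Fin n) n) → (VecUnique.Unique π × HasDes I π) × R (take m (word π))) c →
                  HasSize (λ w → Prefix n w × R w) c
  size-prefixes {n} {R = R} m<n = size-bijection (take m ∘ word)
    (λ {π} (x , r) → prefix-of J-last ∈I⇒≤m (|take| π) (split π x) m<n , r)
    (λ {π} {ρ} (x , _) (y , _) eq → word-injective (begin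
      word π                                               ≡⟨ reconstruct π x ⟩
      take m (word π) ++ complement n (take m (word π))    ≡⟨ cong (λ w → w ++ complement n w) eq ⟩
      take m (word ρ) ++ complement n (take m (word ρ))    ≡⟨ reconstruct ρ y ⟨
      word ρ                                               ∎))
    surj
    where
    open ≡-Reasoning
    |take| : ∀ (π : Vec (Fin n) n) → length (take m (word π)) ≡ m
    |take| π = trans (length-take m (word π)) (m≤n⇒m⊓n≡m (subst (m ≤_) (sym (length-word π)) (<⇒≤ m<n)))
    split : ∀ (π : Vec (Fin n) n) → VecUnique.Unique π × HasDes I π → Arrangement J n (take m (word π) ++ drop m (word π))
    split π x = subst (Arrangement J n) (sym (take++drop≡id m (word π))) (to (HasDes⇔Arrangement m<n) x)
    reconstruct : ∀ (π : Vec (Fin n) n) → VecUnique.Unique π × HasDes I π →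
                  word π ≡ take m (word π) ++ complement n (take m (word π))
    reconstruct π x = trans (sym (take++drop≡id m (word π)))
      (cong (take m (word π) ++_) (tail-complement J-last ∈I⇒≤m (|take| π) (split π x) m<n))
    surj : ∀ {w} → Prefix n w × R w →
           ∃[ π ] ((VecUnique.Unique π × HasDes I π) × R (take m (word π))) × take m (word π) ≡ w
    surj {w} (p , r) =
      π , (from (HasDes⇔Arrangement m<n) (subst (Arrangement J n) (sym word-π) arr) , subst R (sym take-π) r) , take-π
      where
      arr = extend J-last ∈I⇒≤m m<n p
      l   = w ++ complement n w
      preimage : ∃[ π ] word {n} {n} π ≡ l
      preimage = subst (λ k → ∃[ π ] word {n} {k} π ≡ l) (Arrangement.length≡ arr) (word-onto (Arrangement.bounded arr))
      π = proj₁ preimage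
      word-π = proj₂ preimage
      take-π : take m (word π) ≡ w
      take-π = trans (cong (take m) word-π)
        (subst (λ m → take m l ≡ w) (Prefix.length≡ p) (take-length-++ w))

  -- No letter is forced, and the top `n ∸ m` letters are free.
  size-d : ∀ {n} → m < n → HasSize (Filling 0 (n ∸ m)) (d I n)
  size-d {n} m<n = size-cong (mk⇔
      (λ (p , _) → subst (λ n → Prefix n _) n≡ p , λ ())
      (λ (p , _) → subst (λ n → Prefix n _) (sym n≡) p , _))
    (size-prefixes {R = λ _ → ⊤} m<n (size-cong (mk⇔ (_, _) proj₁) (size-count n (hasDes? I))))
    where
    n≡ : n ≡ m + 0 + (n ∸ m)
    n≡ = trans (sym (m+[n∸m]≡n (<⇒≤ m<n))) (cong (_+ (n ∸ m)) (sym (+-identityʳ m)))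

  -- A 1-based letter `suc u` corresponds to `u`. The value 0 has no 0-based form, but it lies below
  -- both intervals.
  Counted⇔Top : ∀ {k} {π : Vec (Fin (2 * m)) (2 * m)} → k ≤ m →
                Counted I k π ⇔ (HasDes I π × Top k (take m (word π)))
  Counted⇔Top {k} {π} k≤m = mk⇔ forth back
    where
    forth : Counted I k π → HasDes I π × Top k (take m (word π))
    forth (des , ⊆k , k⊆) = des , λ u m≤u u<2m →
      let m+1≤ = subst (_≤ suc u) (+-comm 1 m) (s≤s m≤u) in mk⇔
      (λ u∈ → proj₂ (⊆k (from FirstLetters-suc u∈ , m+1≤ , u<2m)))
      (λ u<m+k → to FirstLetters-suc (proj₁ (k⊆ (m+1≤ , u<m+k))))
    back : HasDes I π × Top k (take m (word π)) → Counted I k π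
    back (des , top) = des ,
      (λ { {zero}  (_ , m+1≤ , _) → contradiction m+1≤ m+1≰0
         ; {suc u} (f , m+1≤ , u<2m) → m+1≤ , to (top _ (m≤ m+1≤) u<2m) (to FirstLetters-suc f) }) ,
      (λ { {zero}  (m+1≤ , _) → contradiction m+1≤ m+1≰0
         ; {suc u} (m+1≤ , u<m+k) →
           let u<2m = ≤-trans u<m+k m+k≤2m in
           from FirstLetters-suc (from (top _ (m≤ m+1≤) u<2m) u<m+k) , m+1≤ , u<2m })
      where
      m+1≰0 : ¬ m + 1 ≤ 0
      m+1≰0 = n≮0 ∘ subst (_≤ 0) (+-comm m 1)
      m≤ : ∀ {u} → m + 1 ≤ suc u → m ≤ u
      m≤ {u} m+1≤ = s≤s⁻¹ (subst (_≤ suc u) (+-comm m 1) m+1≤)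
      m+k≤2m : m + k ≤ 2 * m
      m+k≤2m = +-monoʳ-≤ m (≤-trans k≤m (≤-reflexive (sym (+-identityʳ m))))

  size-a : ∀ {k} → k ≤ m → HasSize (Filling k 0) (a k I)
  size-a {zero}  _   = size-empty Filling-0
  size-a {suc k} k≤m = size-cong (Prefix-Top⇔Filling k≤m) (size-prefixes m<2m
    (size-cong (mk⇔
        (λ (u , c) → let des , top = to (Counted⇔Top k≤m) c in (u , des) , top)
        (λ ((u , des) , top) → u , from (Counted⇔Top k≤m) (des , top)))
      (size-count (2 * m) (counted? I (suc k)))))
    where
    m<2m : m < 2 * m
    m<2m = subst (_< 2 * m) (+-identityʳ m) (+-monoʳ-< m (subst (0 <_) (sym (+-identityʳ m)) 0<m))

-- For empty `I` the identity fails: m = 0 makes the sum 0, while the identity permutation gives d =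
-- 1. Hence `I ≢ []`.
theorem3p3 : (I : List ℕ) → I ≢ [] → (∀ {i} → i ∈ I → 0 < i) →
    let m = maxI I in
    (∀ n → m < n → d I n ≡ ∑₀ m (λ k → a k I * ((n ∸ m) C k)))
    × (∀ k → 1 ≤ k → k ≤ m → 0 < a k I)
theorem3p3 I I≢[] I>0 =
  -- Start of the recursion: j = 0 forced letters, so that M = m.
  (λ n m<n → size-Filling (n ∸ m) m 0 refl size-a (size-d m<n)) ,
  (λ k 0<k k≤m → size-positive (size-a k≤m)
    (Filling-nonempty J-last ∈I⇒≤m (λ i → _∈?_ _≟_ (suc i) I) k 0<k k≤m))
  where
  open DescentSet I I≢[] I>0
  open Prefixes m 0<m J
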